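{- Let $n \ge 2$ and let $Y$ be a multisubset of $\mathbb{R}$ of cardinality $N_n$ (counted with multiplicity), where $N_n = \sum_{k=0}^{n-2} \frac{(n-2)!}{(n-2-k)!} = 1 + (n-2) + (n-2)(n-3) + \dots + (n-2)!$. There exist a weighted complete graph $G$ with $[n]=\{1,\dots,n\}$ as set of vertices and two distinct vertices $i,j \in [n]$ such that $Y = \mathcal{D}_{i,j}(G)$ (equality of multisets) if and only if, for some distinct $i,j\in[n]$, the elements of $Y$ (counted with multiplicity) can be indexed bijectively by the finite sequences $(i,i_1,\dots,i_r,j)$ of elements of $[n]$ from $i$ to $j$ without repetitions ($r \ge 0$), the element with index $(i,i_1,\dots,i_r,j)$ being denoted $y_{i,i_1,\dots,i_r,j}$, in such a way that: (a) for any $r>2$ and any pairwise distinct $i_1,\dots,i_r \in [n]\setminus\{i,j\}$, $$ y_{i,i_1,\dots,i_r,j} = \frac{1}{2}\left( y_{i,i_1,i_r,j} - y_{i,i_r,i_1,j} + \sum_{s=1}^{r-1}\left( y_{i,i_s,i_{s+1},j} + y_{i,i_{s+1},i_s,j}\right)\right) - \sum_{s=2}^{r-1} y_{i,i_s,j};$$ (b) for any pairwise distinct $l,o,m \in [n]\setminus\{i,j\}$, $$ y_{i,m,l,j} + y_{i,o,m,j} + y_{i,l,o,j} = y_{i,l,m,j} + y_{i,m,o,j} + y_{i,o,l,j}.$$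
   Context: A weighted complete graph with vertex set $[n]=\{1,\dots,n\}$ is the complete simple graph on $[n]$ in which every edge $\{l,m\}$ is endowed with an arbitrary real number, its weight (not necessarily positive). A simple path between distinct vertices $i$ and $j$ is a path with ends $i$ and $j$ whose vertices are all distinct; it is denoted by the sequence $(i,i_1,\dots,i_r,j)$ of its vertices, $r\ge 0$ (paths are unoriented, so a sequence and its reverse denote the same path). The weight $w_G(p)$ of a path $p$ is the sum of the weights of its edges. $\mathcal{D}_{i,j}(G)$ is the multiset $\{ w_G(p) : p \text{ a simple path between } i \text{ and } j\}$, with one entry for each simple path. $N_n$ is the number of simple paths between two distinct vertices of the complete graph on $[n]$. A multisubset of $\mathbb{R}$ is a multiset of real numbers. -}

module Defs where

open import Data.Fin.Base using (Fin; zero; suc; inject₁; fromℕ)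
import Data.Fin.Properties as Fin
open import Data.List.Base
  using (List; []; _∷_; _∷ʳ_; length; lookup; map; concatMap; filter;
         upTo; allFin; cartesianProductWith)
import Data.List.Relation.Binary.Permutation.Setoid as Permutation
import Data.List.Relation.Unary.Unique.DecPropositional as DecUnique
open import Data.Nat.Base as ℕ using (ℕ; zero; suc; _∸_; _!; _⊔_)
import Data.Nat.DivMod as ℕ
import Data.Nat.ListAction as ℕ
import Data.Nat.Properties as ℕ
open import Data.Product.Base using (_×_; _,_; ∃-syntax)
open import Data.Rational.Base as ℚ using (ℚ; 0ℚ; ½; ∣_∣)
import Data.Rational.Properties as ℚ
open import Data.Rational.Solver using (module +-*-Solver)
open import Data.Vec.Functional using (Vector; foldr; toList)
open import Function.Bundles using (_↔_; Inverse)
open import Function.Definitions using (Injective)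
open import Level using (0ℓ)
open import Relation.Binary.Bundles using (Setoid)
open import Relation.Binary.PropositionalEquality
  using (_≡_; _≢_; refl; sym; trans; cong; subst)

-- The real numbers, as rational Cauchy sequences; two sequences denote
-- the same real number when their difference tends to 0. Real numbers
-- must therefore be compared with _≈_, never with _≡_.

record ℝ : Set where
  constructor mkℝ
  field
    seq    : ℕ → ℚ
    cauchy : ∀ ε → 0ℚ ℚ.< ε →
             ∃[ N ] (∀ m n → N ℕ.≤ m → N ℕ.≤ n → ∣ seq m ℚ.- seq n ∣ ℚ.< ε)

open ℝ public

infix  4 _≈_
infixl 6 _+_ _-_
infix  8 -_
infixr 7 ½*_

_≈_ : ℝ → ℝ → Set
x ≈ y = ∀ ε → 0ℚ ℚ.< ε →
        ∃[ N ] (∀ n → N ℕ.≤ n → ∣ seq x n ℚ.- seq y n ∣ ℚ.< ε)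

0<½*ε : ∀ {ε} → 0ℚ ℚ.< ε → 0ℚ ℚ.< ½ ℚ.* ε
0<½*ε {ε} 0<ε = subst (ℚ._< ½ ℚ.* ε) (ℚ.*-zeroʳ ½) (ℚ.*-monoʳ-<-pos ½ 0<ε)

½*ε+½*ε≡ε : ∀ ε → ½ ℚ.* ε ℚ.+ ½ ℚ.* ε ≡ ε
½*ε+½*ε≡ε ε = trans (sym (ℚ.*-distribʳ-+ ε ½ ½)) (ℚ.*-identityˡ ε)

∣p+q∣<ε : ∀ {ε} p q → ∣ p ∣ ℚ.< ½ ℚ.* ε → ∣ q ∣ ℚ.< ½ ℚ.* ε → ∣ p ℚ.+ q ∣ ℚ.< ε
∣p+q∣<ε {ε} p q ∣p∣< ∣q∣< =
  ℚ.≤-<-trans (ℚ.∣p+q∣≤∣p∣+∣q∣ p q)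
    (subst (∣ p ∣ ℚ.+ ∣ q ∣ ℚ.<_) (½*ε+½*ε≡ε ε) (ℚ.+-mono-< ∣p∣< ∣q∣<))

∣p-q∣≡∣q-p∣ : ∀ p q → ∣ p ℚ.- q ∣ ≡ ∣ q ℚ.- p ∣
∣p-q∣≡∣q-p∣ p q = trans
  (cong ∣_∣ (solve 2 (λ p q → p :- q := :- (q :- p)) refl p q))
  (ℚ.∣-p∣≡∣p∣ (q ℚ.- p))
  where open +-*-Solver

∣p-p∣<ε : ∀ {ε} p → 0ℚ ℚ.< ε → ∣ p ℚ.- p ∣ ℚ.< ε
∣p-p∣<ε {ε} p = subst (ℚ._< ε) (cong ∣_∣ (sym (ℚ.+-inverseʳ p)))

≈-refl : ∀ {x} → x ≈ x
≈-refl {x} ε 0<ε = 0 , λ n _ → ∣p-p∣<ε (seq x n) 0<ε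

≈-sym : ∀ {x y} → x ≈ y → y ≈ x
≈-sym {x} {y} x≈y ε 0<ε with N , x≈y< ← x≈y ε 0<ε =
  N , λ n N≤n → subst (ℚ._< ε) (∣p-q∣≡∣q-p∣ (seq x n) (seq y n)) (x≈y< n N≤n)

≈-trans : ∀ {x y z} → x ≈ y → y ≈ z → x ≈ z
≈-trans {x} {y} {z} x≈y y≈z ε 0<ε
  with M , x≈y< ← x≈y (½ ℚ.* ε) (0<½*ε 0<ε)
     | N , y≈z< ← y≈z (½ ℚ.* ε) (0<½*ε 0<ε) =
  M ⊔ N , λ n M⊔N≤n → subst (λ p → ∣ p ∣ ℚ.< ε)
    (solve 3 (λ p q r → (p :- q) :+ (q :- r) := p :- r) refl
      (seq x n) (seq y n) (seq z n))
    (∣p+q∣<ε (seq x n ℚ.- seq y n) (seq y n ℚ.- seq z n)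
      (x≈y< n (ℕ.m⊔n≤o⇒m≤o M N M⊔N≤n))
      (y≈z< n (ℕ.m⊔n≤o⇒n≤o M N M⊔N≤n)))
  where open +-*-Solver

ℝ-setoid : Setoid 0ℓ 0ℓ
ℝ-setoid = record
  { Carrier       = ℝ
  ; _≈_           = _≈_
  ; isEquivalence = record
    { refl  = λ {x} → ≈-refl {x}
    ; sym   = λ {x} {y} → ≈-sym {x} {y}
    ; trans = λ {x} {y} {z} → ≈-trans {x} {y} {z}
    }
  }

0ℝ : ℝ
0ℝ = mkℝ (λ _ → 0ℚ) λ ε 0<ε → 0 , λ _ _ _ _ → ∣p-p∣<ε 0ℚ 0<ε

_+_ : ℝ → ℝ → ℝ
seq    (x + y) n = seq x n ℚ.+ seq y n
cauchy (x + y) ε 0<ε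
  with M , x< ← cauchy x (½ ℚ.* ε) (0<½*ε 0<ε)
     | N , y< ← cauchy y (½ ℚ.* ε) (0<½*ε 0<ε) =
  M ⊔ N , λ m n ≤m ≤n → subst (λ p → ∣ p ∣ ℚ.< ε)
    (solve 4 (λ p q r s → (p :- q) :+ (r :- s) := (p :+ r) :- (q :+ s)) refl
      (seq x m) (seq x n) (seq y m) (seq y n))
    (∣p+q∣<ε (seq x m ℚ.- seq x n) (seq y m ℚ.- seq y n)
      (x< m n (ℕ.m⊔n≤o⇒m≤o M N ≤m) (ℕ.m⊔n≤o⇒m≤o M N ≤n))
      (y< m n (ℕ.m⊔n≤o⇒n≤o M N ≤m) (ℕ.m⊔n≤o⇒n≤o M N ≤n)))
  where open +-*-Solver

-_ : ℝ → ℝ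
seq    (- x) n = ℚ.- seq x n
cauchy (- x) ε 0<ε with N , x< ← cauchy x ε 0<ε =
  N , λ m n N≤m N≤n → subst (λ p → ∣ p ∣ ℚ.< ε)
    (solve 2 (λ p q → q :- p := :- p :- :- q) refl (seq x m) (seq x n))
    (x< n m N≤n N≤m)
  where open +-*-Solver

_-_ : ℝ → ℝ → ℝ
x - y = x + (- y)

½*_ : ℝ → ℝ
seq    (½* x) n = ½ ℚ.* seq x n
cauchy (½* x) ε 0<ε with N , x< ← cauchy x ε 0<ε =
  N , λ m n N≤m N≤n → subst (ℚ._< ε)
    (trans (sym (ℚ.∣p*q∣≡∣p∣*∣q∣ ½ (seq x m ℚ.- seq x n)))
      (cong ∣_∣ (solve 3 (λ h p q → h :* (p :- q) := h :* p :- h :* q) refl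
        ½ (seq x m) (seq x n))))
    (ℚ.<-≤-trans (ℚ.*-monoʳ-<-pos ½ (x< m n N≤m N≤n)) (½*ε≤ε 0<ε))
  where
  open +-*-Solver
  ½*ε≤ε : ∀ {ε} → 0ℚ ℚ.< ε → ½ ℚ.* ε ℚ.≤ ε
  ½*ε≤ε {ε} 0<ε = ℚ.<⇒≤ (subst (½ ℚ.* ε ℚ.<_) (½*ε+½*ε≡ε ε)
    (subst (ℚ._< ½ ℚ.* ε ℚ.+ ½ ℚ.* ε) (ℚ.+-identityʳ (½ ℚ.* ε))
      (ℚ.+-monoʳ-< (½ ℚ.* ε) (0<½*ε 0<ε))))

∑ : ∀ {k} → Vector ℝ k → ℝ
∑ = foldr _+_ 0ℝ

-- Multisets of real numbers are lists up to _↭_.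
open Permutation ℝ-setoid public using (_↭_)

-- The values weight l l are not part of the data of the graph; they never
-- contribute to the weight of a path without repeated vertices.
record WeightedCompleteGraph (n : ℕ) : Set where
  field
    weight     : Fin n → Fin n → ℝ
    weight-sym : ∀ l m → weight l m ≈ weight m l

open WeightedCompleteGraph public

pathWeight : ∀ {n} → WeightedCompleteGraph n → List (Fin n) → ℝ
pathWeight G (l ∷ m ∷ ms) = weight G l m + pathWeight G (m ∷ ms)
pathWeight G _            = 0ℝ

module _ {n : ℕ} where
  open DecUnique (Fin._≟_ {n}) public using (Unique; unique?)

-- An unoriented simple path between distinct vertices i and j has exactly
-- one sequence of vertices starting at i, and this sequence is determined
-- by its interior (i₁,…,iᵣ). Irrelevance of the proof makes equality of
-- simple paths the equality of their vertex sequences.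
record SimplePath {n : ℕ} (i j : Fin n) : Set where
  constructor mkPath
  field
    interior : List (Fin n)
    .simple  : Unique (i ∷ interior ∷ʳ j)

open SimplePath public using (interior)

sequences : (n r : ℕ) → List (List (Fin n))
sequences n zero    = [] ∷ []
sequences n (suc r) = cartesianProductWith _∷_ (allFin n) (sequences n r)

-- The interiors of the simple paths from i to j, each listed once. Such an
-- interior has at most n - 2 vertices, so no length r ≥ n has to be tried.
interiors : ∀ {n} (i j : Fin n) → List (List (Fin n))
interiors {n} i j =
  filter (λ is → unique? (i ∷ is ∷ʳ j)) (concatMap (sequences n) (upTo n))

𝒟 : ∀ {n} (i j : Fin n) → WeightedCompleteGraph n → List ℝ
𝒟 i j G = map (λ is → pathWeight G (i ∷ is ∷ʳ j)) (interiors i j)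

-- Meaningful for n ≥ 2 only, because of the truncated subtraction.
N : ℕ → ℕ
N n = ℕ.sum (map term (upTo (suc (n ∸ 2))))
  where
  term : ℕ → ℕ
  term k = ((n ∸ 2) !) ℕ./ ((n ∸ 2 ∸ k) !)
    where instance _ = (n ∸ 2 ∸ k) ℕ.!≢0

-- y (i₁ ∷ … ∷ iᵣ ∷ []) is the element y_{i,i₁,…,iᵣ,j} of Y. For convenience
-- y is a total function on lists; it is determined by the bijection on the
-- interiors of simple paths and irrelevant elsewhere.
record Indexing (Y : List ℝ) {n : ℕ} (i j : Fin n) : Set where
  field
    position : SimplePath i j ↔ Fin (length Y)
    y        : List (Fin n) → ℝ
    y-lookup : ∀ p → y (interior p) ≈ lookup Y (Inverse.to position p)

module _ {Y : List ℝ} {n : ℕ} {i j : Fin n} (I : Indexing Y i j) where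
  open Indexing I

  -- The sequence (i₁,…,iᵣ) is v, with r = 3 + k and indices shifted by one.
  ConditionA : Set
  ConditionA =
    ∀ k (v : Vector (Fin n) (3 ℕ.+ k)) →
    Injective _≡_ _≡_ v → (∀ s → v s ≢ i × v s ≢ j) →
    let i₁ = v zero
        iᵣ = v (fromℕ (2 ℕ.+ k))
    in
    y (toList v) ≈
      ½* ( y (i₁ ∷ iᵣ ∷ []) - y (iᵣ ∷ i₁ ∷ [])
         + ∑ {2 ℕ.+ k} (λ s → y (v (inject₁ s) ∷ v (suc s) ∷ [])
                            + y (v (suc s) ∷ v (inject₁ s) ∷ [])))
      - ∑ {1 ℕ.+ k} (λ s → y (v (suc (inject₁ s)) ∷ []))

  ConditionB : Set
  ConditionB =
    ∀ l o m → l ≢ o → o ≢ m → l ≢ m →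
    l ≢ i × l ≢ j → o ≢ i × o ≢ j → m ≢ i × m ≢ j →
    y (m ∷ l ∷ []) + y (o ∷ m ∷ []) + y (l ∷ o ∷ []) ≈
    y (l ∷ m ∷ []) + y (m ∷ o ∷ []) + y (o ∷ l ∷ [])

{-# OPTIONS --safe #-}
module Submission where

open import Defs
open import Algebra.Bundles using (CommutativeMonoid)
open import Algebra.Core using (Op₁; Op₂)
import Algebra.Solver.CommutativeMonoid
open import Algebra.Structures using (IsCommutativeMonoid)
open import Data.Bool.Base using (if_then_else_)
open import Data.Fin.Base using (Fin; zero; suc; inject₁; fromℕ; cast)
import Data.Fin.Permutation as Fin
import Data.Fin.Properties as Fin
open import Data.List.Base
  using (List; []; _∷_; _∷ʳ_; length; lookup; map; allFin; upTo; concatMap)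
open import Data.List.Membership.Propositional using (_∈_)
import Data.List.Membership.Propositional.Properties as ∈
open import Data.List.Membership.Propositional.Properties.WithK using (unique∧set⇒bag)
import Data.List.Properties as List
open import Data.List.Relation.Binary.BagAndSetEquality using (∼bag⇒↭)
open import Data.List.Relation.Binary.Disjoint.Propositional using (Disjoint)
import Data.List.Relation.Binary.Permutation.Homogeneous as Homogeneous
import Data.List.Relation.Binary.Permutation.Propositional as Propositional
import Data.List.Relation.Binary.Permutation.Setoid as Setoid↭
import Data.List.Relation.Binary.Permutation.Setoid.Properties as Setoid↭ₚ
open import Data.List.Relation.Binary.Pointwise as Pointwise using (Pointwise)
open import Data.List.Relation.Unary.All as All using (All; []; _∷_)
import Data.List.Relation.Unary.All.Properties as All
open import Data.List.Relation.Unary.AllPairs as AllPairs using ([]; _∷_)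
import Data.List.Relation.Unary.AllPairs.Properties as AllPairs
open import Data.List.Relation.Unary.Any as Any using (here)
import Data.List.Relation.Unary.Any.Properties as Any
import Data.List.Relation.Unary.Unique.Propositional as Propositional
import Data.List.Relation.Unary.Unique.Propositional.Properties as Unique
open import Data.Nat.Base as ℕ using (ℕ; zero; suc; _≤_; _⊔_)
import Data.Nat.Properties as ℕ
open import Data.Product.Base using (_×_; _,_; proj₁; proj₂; Σ-syntax)
open import Data.Rational.Base as ℚ using (ℚ; 0ℚ; ½; ∣_∣)
import Data.Rational.Properties as ℚ
open import Data.Rational.Solver using (module +-*-Solver)
open import Data.Vec.Functional using (Vector; toList; tail)
open import Function.Base using (_∘_; id)
open import Function.Bundles using (_⇔_; _↔_; mk⇔; mk↔ₛ′; Inverse; Injection)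
open import Function.Definitions using (Injective)
open import Function.Properties.Inverse using (↔⇒↣; ↔-sym; ↔-trans)
open import Level using (0ℓ)
open import Relation.Binary.Bundles using (Setoid)
open import Relation.Binary.Core using (Rel)
open import Relation.Binary.Definitions using (DecidableEquality)
open import Relation.Binary.PropositionalEquality
  using (_≡_; _≢_; refl; sym; trans; cong; cong₂; subst; subst₂; setoid)
open import Relation.Nullary
  using (yes; no; does; contradiction; recompute; ¬?; _×-dec_)
open import Relation.Nullary.Decidable using (dec-true; dec-false)

-- An interior vertex a enters the weight of a path through w(i,a), w(a,j) and
-- w(a,b) only, so the weights of the paths with at most two interior vertices
-- determine 2w(a,b) = y_ab + y_ba - y_a - y_b and the differences
-- w(i,a) - w(i,b) = d(a,b) := (y_ab - y_ba + y_a - y_b) / 2. Substituting this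
-- into the weight of a longer path, the sum along the path telescopes to (a).
-- Conversely d is the coboundary of some w(i,-) exactly when its cyclic sums
-- vanish, which is (b); then w(a,j) = y_a - w(i,a), and (a) takes care of the
-- longer paths.

-- Distinctness of list entries and of neighbouring indices.

lookup-injective : ∀ {A : Set} {xs : List A} → Propositional.Unique xs →
  Injective _≡_ _≡_ (lookup xs)
lookup-injective {xs = _ ∷ _} _ {zero} {zero} _ = refl
lookup-injective {xs = _ ∷ _} (x∉xs ∷ _) {zero} {suc t} eq =
  contradiction eq (All.lookup x∉xs (∈.∈-lookup t))
lookup-injective {xs = _ ∷ _} (x∉xs ∷ _) {suc s} {zero} eq =
  contradiction (sym eq) (All.lookup x∉xs (∈.∈-lookup s))
lookup-injective {xs = _ ∷ _} (_ ∷ xs!) {suc s} {suc t} eq = cong suc (lookup-injective xs! eq)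

inject₁≢suc : ∀ {n} (s : Fin n) → inject₁ s ≢ suc s
inject₁≢suc (suc s) = inject₁≢suc s ∘ Fin.suc-injective

-- Linear equations over a commutative monoid with subtraction and halving.

-- ∑ and, below, the path weight W are given by their recursion equations up to
-- _≈_: unfolding them at ℝ would make Agda compare the proofs of Cauchyness.
module PathSums
  {A : Set} {_≈_ : Rel A 0ℓ} {_+_ _-_ : Op₂ A} {0# : A} {½*_ : Op₁ A}
  {∑ : ∀ {k} → Vector A k → A}
  (isCommutativeMonoid : IsCommutativeMonoid _≈_ _+_ 0#)
  (minus-cong : ∀ {p q r s} → p ≈ q → r ≈ s → (p - r) ≈ (q - s))
  ([p-q]+q≈p : ∀ p q → ((p - q) + q) ≈ p)
  ([p+q]-q≈p : ∀ p q → ((p + q) - q) ≈ p)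
  (½*-cong : ∀ {p q} → p ≈ q → (½* p) ≈ (½* q))
  (½*[p+p]≈p : ∀ p → (½* (p + p)) ≈ p)
  (½*p+½*p≈p : ∀ p → ((½* p) + (½* p)) ≈ p)
  (∑-zero : (f : Vector A 0) → ∑ f ≈ 0#)
  (∑-suc : ∀ {k} (f : Vector A (suc k)) → ∑ f ≈ (f zero + ∑ (f ∘ suc)))
  where

  +-commutativeMonoid : CommutativeMonoid 0ℓ 0ℓ
  +-commutativeMonoid = record { isCommutativeMonoid = isCommutativeMonoid }

  module ≈ = IsCommutativeMonoid isCommutativeMonoid
  open Algebra.Solver.CommutativeMonoid +-commutativeMonoid 
    using (_⊕_; _⊜_) renaming (solve to rearrange; id to 0′)

  -- The pattern of the linear computations below: `p ≈ q` bundles all equations that are to be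
  -- used, and what remains is a mere reordering of summands, which the monoid solver proves.
  +-cancel : ∀ {p q x y} → p ≈ q → (x + q) ≈ (p + y) → x ≈ y
  +-cancel {p} {q} {x} {y} p≈q x+q≈p+y =
    ≈.trans (≈.sym ([p+q]-q≈p x q))
      (≈.trans (minus-cong (≈.trans x+q≈p+y (≈.trans (≈.∙-cong p≈q ≈.refl) (≈.comm q y))) ≈.refl)
        ([p+q]-q≈p y q))

  double-injective : ∀ {p q} → (p + p) ≈ (q + q) → p ≈ q
  double-injective {p} {q} eq =
    ≈.trans (≈.sym (½*[p+p]≈p p)) (≈.trans (½*-cong eq) (½*[p+p]≈p q))

  ½*[p-q]+½*[p-q]+q≈p : ∀ p q → (((½* (p - q)) + (½* (p - q))) + q) ≈ p
  ½*[p-q]+½*[p-q]+q≈p p q = ≈.trans (≈.∙-cong (½*p+½*p≈p (p - q)) ≈.refl) ([p-q]+q≈p p q)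

  -- Clears condition (a) of its half and its differences: here x is the long path weight, p and q
  -- the weights through both end vertices, r the sum over neighbours, m the sum over inner
  -- vertices.
  ½*-unique : ∀ {p q r m x} → (p + r) ≈ (q + ((x + m) + (x + m))) →
    x ≈ ((½* ((p - q) + r)) - m)
  ½*-unique {p} {q} {r} {m} {x} eq =
    ≈.trans (≈.sym ([p+q]-q≈p x m)) (minus-cong (double-injective
      (≈.trans
        (+-cancel (≈.∙-cong (≈.sym eq) (≈.sym ([p-q]+q≈p p q)))
          -- The difference `p - q` is an opaque summand d, known only through d + q ≈ p.
          (rearrange 6 (λ p q d r m x →
              ((x ⊕ m) ⊕ (x ⊕ m)) ⊕ ((p ⊕ r) ⊕ (d ⊕ q)) ⊜
              ((q ⊕ ((x ⊕ m) ⊕ (x ⊕ m))) ⊕ p) ⊕ (d ⊕ r))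
            ≈.refl p q (p - q) r m x))
        (≈.sym (½*p+½*p≈p ((p - q) + r))))) ≈.refl)

  ∑-cong : ∀ {k} {f g : Vector A k} → (∀ s → f s ≈ g s) → ∑ f ≈ ∑ g
  ∑-cong {zero}  {f} {g} f≈g = ≈.trans (∑-zero f) (≈.sym (∑-zero g))
  ∑-cong {suc k} {f} {g} f≈g = ≈.trans (∑-suc f)
    (≈.trans (≈.∙-cong (f≈g zero) (∑-cong (f≈g ∘ suc))) (≈.sym (∑-suc g)))

  -- Path weights of a graph, and why they satisfy (a) and (b).

  module _ {V : Set} where

    -- The right-hand side of (a), over an abstract carrier and for an arbitrary family y.
    interpolation : ∀ k → (List V → A) → Vector V (3 ℕ.+ k) → A
    interpolation k y v =
      (½* ( (y (v zero ∷ v (fromℕ (2 ℕ.+ k)) ∷ []) - y (v (fromℕ (2 ℕ.+ k)) ∷ v zero ∷ []))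
         + ∑ {2 ℕ.+ k} (λ s → y (v (inject₁ s) ∷ v (suc s) ∷ [])
                            + y (v (suc s) ∷ v (inject₁ s) ∷ []))))
      - ∑ {1 ℕ.+ k} (λ s → y (v (suc (inject₁ s)) ∷ []))

    -- The formula reads y only at single inner vertices and at pairs of distinct ones: first and
    -- last index differ, neighbouring indices differ, and v is injective.
    interpolation-cong : ∀ {k} {y y′ : List V → A} {Inner : V → Set} →
      (∀ {a} → Inner a → y (a ∷ []) ≈ y′ (a ∷ [])) →
      (∀ {a b} → a ≢ b → Inner a → Inner b → y (a ∷ b ∷ []) ≈ y′ (a ∷ b ∷ [])) →
      (v : Vector V (3 ℕ.+ k)) → Injective _≡_ _≡_ v → (∀ s → Inner (v s)) →
      interpolation k y v ≈ interpolation k y′ v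
    interpolation-cong {k} {y} {y′} singles pairs v v-injective inner =
      minus-cong
        (½*-cong (≈.∙-cong
          (minus-cong (pair λ ()) (pair λ ()))
          (∑-cong λ s → ≈.∙-cong (pair (inject₁≢suc s)) (pair (inject₁≢suc s ∘ sym)))))
        (∑-cong λ s → singles (inner (suc (inject₁ s))))
      where
      pair : ∀ {s t} → s ≢ t → y (v s ∷ v t ∷ []) ≈ y′ (v s ∷ v t ∷ [])
      pair {s} {t} s≢t = pairs (s≢t ∘ v-injective) (inner s) (inner t)

    module Graph
      (w : V → V → A) (w-sym : ∀ a b → w a b ≈ w b a)
      (W : List V → A)
      (W-[-] : ∀ a → W (a ∷ []) ≈ 0#)
      (W-∷ : ∀ a b is → W (a ∷ b ∷ is) ≈ (w a b + W (b ∷ is)))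
      (i j : V)
      where

      pathSum : List V → A
      pathSum is = W (i ∷ (is ∷ʳ j))

      W-edge : ∀ a b → W (a ∷ b ∷ []) ≈ w a b
      W-edge a b = ≈.trans (W-∷ a b []) (≈.trans (≈.∙-cong ≈.refl (W-[-] b)) (≈.identityʳ (w a b)))

      pathSum-single : ∀ a → pathSum (a ∷ []) ≈ (w i a + w a j)
      pathSum-single a = ≈.trans (W-∷ i a _) (≈.∙-cong ≈.refl (W-edge a j))

      pathSum-pair : ∀ a b → pathSum (a ∷ b ∷ []) ≈ (w i a + (w a b + w b j))
      pathSum-pair a b = ≈.trans (W-∷ i a _)
        (≈.∙-cong ≈.refl (≈.trans (W-∷ a b _) (≈.∙-cong ≈.refl (W-edge b j))))

      pairSum : ∀ {k} → Vector V (suc k) → A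
      pairSum {k} v = ∑ {k} (λ s → pathSum (v (inject₁ s) ∷ v (suc s) ∷ [])
                                 + pathSum (v (suc s) ∷ v (inject₁ s) ∷ []))

      innerSum : ∀ {k} → Vector V (2 ℕ.+ k) → A
      innerSum {k} v = ∑ {k} (λ s → pathSum (v (suc (inject₁ s)) ∷ []))

      -- Both sides carry the summands which the four terms at the end
      -- vertices of v contribute, so that no subtraction occurs.
      pairSum-pathSum : ∀ k (v : Vector V (2 ℕ.+ k)) →
        let i₁ = v zero
            iᵣ = v (fromℕ (1 ℕ.+ k))
            p  = pathSum (toList v) + innerSum v
        in (pairSum v + (w i i₁ + w iᵣ j)) ≈ ((p + p) + (w i₁ j + w i iᵣ))
      pairSum-pathSum zero v =
        +-cancel
          (≈.∙-cong (w-sym b a)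
          (≈.∙-cong (≈.trans (∑-suc _)
            (≈.∙-cong (≈.∙-cong (pathSum-pair a b) (pathSum-pair b a)) (∑-zero _)))
          (≈.∙-cong (≈.sym (≈.∙-cong (pathSum-pair a b) (∑-zero _)))
                    (≈.sym (≈.∙-cong (pathSum-pair a b) (∑-zero _))))))
          (rearrange 9 (λ ia aj ib bj ab ba T Q M →
              (T ⊕ (ia ⊕ bj)) ⊕
                (ab ⊕ ((((ia ⊕ (ab ⊕ bj)) ⊕ (ib ⊕ (ba ⊕ aj))) ⊕ 0′)
                ⊕ ((Q ⊕ M) ⊕ (Q ⊕ M)))) ⊜
              (ba ⊕ (T ⊕ (((ia ⊕ (ab ⊕ bj)) ⊕ 0′) ⊕ ((ia ⊕ (ab ⊕ bj)) ⊕ 0′))))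
                ⊕ (((Q ⊕ M) ⊕ (Q ⊕ M)) ⊕ (aj ⊕ ib)))
            ≈.refl (w i a) (w a j) (w i b) (w b j) (w a b) (w b a)
            (pairSum v) (pathSum (toList v)) (innerSum v))
        where
        a = v zero
        b = v (suc zero)
      -- Induction by dropping the first vertex a: the pair sum loses both orders of a and b, the
      -- path trades w(i,b) for w(i,a) + w(a,b), and b, no longer an end of v, joins the inner sum.
      pairSum-pathSum (suc k) v =
        +-cancel
          (≈.∙-cong (w-sym b a)
          (≈.∙-cong (≈.trans (∑-suc _)
            (≈.∙-cong (≈.∙-cong (pathSum-pair a b) (pathSum-pair b a)) ≈.refl))
          (≈.∙-cong (pairSum-pathSum k (tail v))
          (≈.∙-cong (double (≈.sym (≈.trans (W-∷ i a _) (≈.∙-cong ≈.refl (W-∷ a b _)))))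
          (≈.∙-cong (double (≈.sym (≈.trans (∑-suc _) (≈.∙-cong (pathSum-single b) ≈.refl))))
                    (double (W-∷ i b _)))))))
          (rearrange 15 (λ ia aj ib bj ab ba ir rj P T Q M T′ Q′ M′ →
              (T ⊕ (ia ⊕ rj)) ⊕
                (ab ⊕ ((((ia ⊕ (ab ⊕ bj)) ⊕ (ib ⊕ (ba ⊕ aj))) ⊕ T′)
                ⊕ ((((Q′ ⊕ M′) ⊕ (Q′ ⊕ M′)) ⊕ (bj ⊕ ir))
                ⊕ ((Q ⊕ Q) ⊕ ((M ⊕ M) ⊕ ((ib ⊕ P) ⊕ (ib ⊕ P))))))) ⊜
              (ba ⊕ (T ⊕ ((T′ ⊕ (ib ⊕ rj))
                ⊕ (((ia ⊕ (ab ⊕ P)) ⊕ (ia ⊕ (ab ⊕ P)))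
                ⊕ ((((ib ⊕ bj) ⊕ M′) ⊕ ((ib ⊕ bj) ⊕ M′)) ⊕ (Q′ ⊕ Q′))))))
                ⊕ (((Q ⊕ M) ⊕ (Q ⊕ M)) ⊕ (aj ⊕ ir)))
            ≈.refl (w i a) (w a j) (w i b) (w b j) (w a b) (w b a) (w i r) (w r j)
            (W (toList (tail v) ∷ʳ j))
            (pairSum v) (pathSum (toList v)) (innerSum v)
            (pairSum (tail v)) (pathSum (toList (tail v))) (innerSum (tail v)))
        where
        a = v zero
        b = v (suc zero)
        r = v (fromℕ (2 ℕ.+ k))
        double : ∀ {p q} → p ≈ q → (p + p) ≈ (q + q)
        double p≈q = ≈.∙-cong p≈q p≈q

      -- The end terms left over in `pairSum-pathSum` are the difference of the weights through i₁,
      -- iᵣ and through iᵣ, i₁, because the edge joining these two vertices contributes equally to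
      -- both.
      interpolation-pathSum : ∀ k (v : Vector V (3 ℕ.+ k)) →
        pathSum (toList v) ≈ interpolation k pathSum v
      interpolation-pathSum k v =
        ½*-unique (+-cancel
          (≈.∙-cong (w-sym a r)
          (≈.∙-cong (pairSum-pathSum (suc k) v)
          (≈.∙-cong (pathSum-pair a r) (≈.sym (pathSum-pair r a)))))
          (rearrange 10 (λ ia aj ir rj ar ra T R Yar Yra →
              (Yar ⊕ T) ⊕ (ra ⊕ ((R ⊕ (aj ⊕ ir)) ⊕ ((ia ⊕ (ar ⊕ rj)) ⊕ Yra))) ⊜
              (ar ⊕ ((T ⊕ (ia ⊕ rj)) ⊕ (Yar ⊕ (ir ⊕ (ra ⊕ aj))))) ⊕ (Yra ⊕ R))
            ≈.refl (w i a) (w a j) (w i r) (w r j) (w a r) (w r a)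
            (pairSum v) ((pathSum (toList v) + innerSum v) + (pathSum (toList v) + innerSum v))
            (pathSum (a ∷ r ∷ [])) (pathSum (r ∷ a ∷ []))))
        where
        a = v zero
        r = v (fromℕ (2 ℕ.+ k))

      -- Each side uses every edge from {l,o,m} to i and to j once, and the three edges of the
      -- triangle once, in opposite directions.
      cyclic-pathSum : ∀ l o m →
        ((pathSum (m ∷ l ∷ []) + pathSum (o ∷ m ∷ [])) + pathSum (l ∷ o ∷ [])) ≈
        ((pathSum (l ∷ m ∷ []) + pathSum (m ∷ o ∷ [])) + pathSum (o ∷ l ∷ []))
      cyclic-pathSum l o m =
        ≈.trans (≈.∙-cong (≈.∙-cong (pathSum-pair m l) (pathSum-pair o m)) (pathSum-pair l o))
        (≈.trans
          (+-cancel (≈.∙-cong (≈.∙-cong (w-sym m l) (w-sym o m)) (w-sym l o))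
            (rearrange 12 (λ il io im lj oj mj ml lm om mo lo ol →
              (((im ⊕ (ml ⊕ lj)) ⊕ (io ⊕ (om ⊕ mj))) ⊕ (il ⊕ (lo ⊕ oj))) ⊕ ((lm ⊕ mo) ⊕ ol) ⊜
              ((ml ⊕ om) ⊕ lo) ⊕ (((il ⊕ (lm ⊕ mj)) ⊕ (im ⊕ (mo ⊕ oj))) ⊕ (io ⊕ (ol ⊕ lj))))
              ≈.refl (w i l) (w i o) (w i m) (w l j) (w o j) (w m j)
              (w m l) (w l m) (w o m) (w m o) (w l o) (w o l)))
          (≈.sym (≈.∙-cong (≈.∙-cong (pathSum-pair l m) (pathSum-pair m o)) (pathSum-pair o l))))

      module _ (Y : List V → A) where

        interpolation-≈-pathSum :
          (∀ is → Y is ≈ pathSum is) → ∀ k v → Y (toList v) ≈ interpolation k Y v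
        interpolation-≈-pathSum Y≈pathSum k v =
          ≈.trans (Y≈pathSum _) (≈.trans (interpolation-pathSum k v) (≈.sym
            (minus-cong
              (½*-cong (≈.∙-cong
                (minus-cong (Y≈pathSum _) (Y≈pathSum _))
                (∑-cong λ s → ≈.∙-cong (Y≈pathSum _) (Y≈pathSum _))))
              (∑-cong λ s → Y≈pathSum _))))

        cyclic-≈-pathSum : (∀ is → Y is ≈ pathSum is) → ∀ l o m →
          ((Y (m ∷ l ∷ []) + Y (o ∷ m ∷ [])) + Y (l ∷ o ∷ [])) ≈
          ((Y (l ∷ m ∷ []) + Y (m ∷ o ∷ [])) + Y (o ∷ l ∷ []))
        cyclic-≈-pathSum Y≈pathSum l o m =
          ≈.trans (≈.∙-cong (≈.∙-cong (Y≈pathSum _) (Y≈pathSum _)) (Y≈pathSum _))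
            (≈.trans (cyclic-pathSum l o m)
              (≈.sym (≈.∙-cong (≈.∙-cong (Y≈pathSum _) (Y≈pathSum _)) (Y≈pathSum _))))

        -- Both families satisfy (a), which expresses the values at longer sequences through those
        -- with one or two inner vertices; agreement on short paths therefore propagates.
        interpolation⇒≈-pathSum : {Inner : V → Set} →
          Y [] ≈ pathSum [] →
          (∀ {a} → Inner a → Y (a ∷ []) ≈ pathSum (a ∷ [])) →
          (∀ {a b} → a ≢ b → Inner a → Inner b → Y (a ∷ b ∷ []) ≈ pathSum (a ∷ b ∷ [])) →
          (∀ k v → Injective _≡_ _≡_ v → (∀ s → Inner (v s)) → Y (toList v) ≈ interpolation k Y v) →
          ∀ {is} → Propositional.Unique is → All Inner is → Y is ≈ pathSum is
        interpolation⇒≈-pathSum empty singles pairs interpolated {[]} _ _ = empty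
        interpolation⇒≈-pathSum empty singles pairs interpolated {_ ∷ []} _ (a-inner ∷ _) = singles a-inner
        interpolation⇒≈-pathSum empty singles pairs interpolated {_ ∷ _ ∷ []}
          ((a≢b ∷ _) ∷ _) (a-inner ∷ b-inner ∷ _) = pairs a≢b a-inner b-inner
        interpolation⇒≈-pathSum empty singles pairs interpolated {is@(_ ∷ _ ∷ _ ∷ rest)} is! inner =
          subst (λ is → Y is ≈ pathSum is) (List.tabulate-lookup is)
            (≈.trans (interpolated (length rest) (lookup is) v-injective v-inner)
            (≈.trans (interpolation-cong {y = Y} {pathSum} singles pairs (lookup is) v-injective v-inner)
              (≈.sym (interpolation-pathSum (length rest) (lookup is)))))
          where
          v-injective : Injective _≡_ _≡_ (lookup is)
          v-injective = lookup-injective is!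
          v-inner = λ s → All.lookup inner (∈.∈-lookup s)

    -- Reconstruction of the edge weights from the indexed values.

    -- The weights are forced up to the choice of the potential startWeight,
    -- which cyclicity determines up to an additive constant; it is normalised
    -- to vanish at the vertex o.
    module Reconstruction (Y : List V → A) (o : V) where

      -- `startWeight a` is d(a,o). At a = o the meaningless value `Y (o ∷ o ∷ [])` occurs on both
      -- sides of the difference and cancels.
      startWeight endWeight : V → A
      startWeight a =
        ½* ((Y (a ∷ o ∷ []) + Y (a ∷ [])) - (Y (o ∷ a ∷ []) + Y (o ∷ [])))
      endWeight a = Y (a ∷ []) - startWeight a

      innerWeight : V → V → A
      innerWeight a b =
        ½* ((Y (a ∷ b ∷ []) + Y (b ∷ a ∷ [])) - (Y (a ∷ []) + Y (b ∷ [])))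

      innerWeight-sym : ∀ a b → innerWeight a b ≈ innerWeight b a
      innerWeight-sym a b = ½*-cong (minus-cong (≈.comm _ _) (≈.comm _ _))

      startWeight+endWeight : ∀ a → (startWeight a + endWeight a) ≈ Y (a ∷ [])
      startWeight+endWeight a = ≈.trans (≈.comm _ _) ([p-q]+q≈p _ _)

      -- Doubling the left side cancels the values at single vertices and leaves y_ab + (y_ao + y_ba
      -- + y_ob) - (y_oa + y_bo). By cyclicity the bracket y_ao + y_ba + y_ob is y_oa + y_ab + y_bo,
      -- so the total is 2 y_ab.
      cyclic⇒pair : ∀ a b →
        ((Y (a ∷ o ∷ []) + Y (b ∷ a ∷ [])) + Y (o ∷ b ∷ [])) ≈
        ((Y (o ∷ a ∷ []) + Y (a ∷ b ∷ [])) + Y (b ∷ o ∷ [])) →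
        (startWeight a + (innerWeight a b + endWeight b)) ≈ Y (a ∷ b ∷ [])
      cyclic⇒pair a b cyclic = double-injective (+-cancel
        (≈.∙-cong (½*[p-q]+½*[p-q]+q≈p _ _)
        (≈.∙-cong (≈.sym (½*[p-q]+½*[p-q]+q≈p _ _))
        (≈.∙-cong (½*[p-q]+½*[p-q]+q≈p _ _)
        (≈.∙-cong (≈.∙-cong (startWeight+endWeight b) (startWeight+endWeight b)) cyclic))))
        (rearrange 13 (λ xa xb zb c a b o ab ba ao oa bo ob →
            ((xa ⊕ (c ⊕ zb)) ⊕ (xa ⊕ (c ⊕ zb))) ⊕
              ((ao ⊕ a) ⊕ (((xb ⊕ xb) ⊕ (ob ⊕ o)) ⊕ ((ab ⊕ ba) ⊕ ((b ⊕ b) ⊕ ((oa ⊕ ab) ⊕ bo))))) ⊜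
            (((xa ⊕ xa) ⊕ (oa ⊕ o)) ⊕ ((bo ⊕ b) ⊕ (((c ⊕ c) ⊕ (a ⊕ b))
              ⊕ (((xb ⊕ zb) ⊕ (xb ⊕ zb)) ⊕ ((ao ⊕ ba) ⊕ ob))))) ⊕ (ab ⊕ ab))
          ≈.refl (startWeight a) (startWeight b) (endWeight b) (innerWeight a b)
          (Y (a ∷ [])) (Y (b ∷ [])) (Y (o ∷ [])) (Y (a ∷ b ∷ [])) (Y (b ∷ a ∷ []))
          (Y (a ∷ o ∷ [])) (Y (o ∷ a ∷ [])) (Y (b ∷ o ∷ [])) (Y (o ∷ b ∷ []))))

      module _ (_≟_ : DecidableEquality V) (i j : V) (i≢j : i ≢ j) where

        Inner : V → Set
        Inner a = a ≢ i × a ≢ j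

        data Kind : Set where
          start end inner : Kind

        kind : V → Kind
        kind a = if does (a ≟ i) then start else if does (a ≟ j) then end else inner

        kind-start : kind i ≡ start
        kind-start rewrite dec-true (i ≟ i) refl = refl

        kind-end : kind j ≡ end
        kind-end rewrite dec-false (j ≟ i) (i≢j ∘ sym) | dec-true (j ≟ j) refl = refl

        kind-inner : ∀ {a} → Inner a → kind a ≡ inner
        kind-inner {a} (a≢i , a≢j) rewrite dec-false (a ≟ i) a≢i | dec-false (a ≟ j) a≢j = refl

        -- The edge between i and j is itself the path with empty interior, whence `Y []`. The
        -- values `0#` belong to loops at i or j. Splitting by kinds makes symmetry a finite check.
        weightOf : Kind → Kind → V → V → A
        weightOf start start _ _ = 0#
        weightOf start end   _ _ = Y []
        weightOf start inner _ b = startWeight b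
        weightOf end   start _ _ = Y []
        weightOf end   end   _ _ = 0#
        weightOf end   inner _ b = endWeight b
        weightOf inner start a _ = startWeight a
        weightOf inner end   a _ = endWeight a
        weightOf inner inner a b = innerWeight a b

        reconstructed : V → V → A
        reconstructed a b = weightOf (kind a) (kind b) a b

        weightOf-sym : ∀ k l a b → weightOf k l a b ≈ weightOf l k b a
        weightOf-sym start start a b = ≈.refl
        weightOf-sym start end   a b = ≈.refl
        weightOf-sym start inner a b = ≈.refl
        weightOf-sym end   start a b = ≈.refl
        weightOf-sym end   end   a b = ≈.refl
        weightOf-sym end   inner a b = ≈.refl
        weightOf-sym inner start a b = ≈.refl
        weightOf-sym inner end   a b = ≈.refl
        weightOf-sym inner inner a b = innerWeight-sym a b

        reconstructed-sym : ∀ a b → reconstructed a b ≈ reconstructed b a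
        reconstructed-sym a b = weightOf-sym (kind a) (kind b) a b

        reconstructed-of-kinds : ∀ {a b k l} → kind a ≡ k → kind b ≡ l →
          reconstructed a b ≈ weightOf k l a b
        reconstructed-of-kinds {a} {b} a↦k b↦l =
          ≈.reflexive (cong₂ (λ k l → weightOf k l a b) a↦k b↦l)

        module _
          (w : V → V → A) (w≈reconstructed : ∀ a b → w a b ≈ reconstructed a b)
          (W : List V → A)
          (W-[-] : ∀ a → W (a ∷ []) ≈ 0#)
          (W-∷ : ∀ a b is → W (a ∷ b ∷ is) ≈ (w a b + W (b ∷ is)))
          (o-inner : ∀ {a} → Inner a → Inner o)
          (interpolated : ∀ k v → Injective _≡_ _≡_ v → (∀ s → Inner (v s)) →
            Y (toList v) ≈ interpolation k Y v)
          (cyclic : ∀ l o m → l ≢ o → o ≢ m → l ≢ m → Inner l → Inner o → Inner m →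
            ((Y (m ∷ l ∷ []) + Y (o ∷ m ∷ [])) + Y (l ∷ o ∷ [])) ≈
            ((Y (l ∷ m ∷ []) + Y (m ∷ o ∷ [])) + Y (o ∷ l ∷ [])))
          where

          w-of-kinds : ∀ {a b k l} → kind a ≡ k → kind b ≡ l → w a b ≈ weightOf k l a b
          w-of-kinds a↦k b↦l = ≈.trans (w≈reconstructed _ _) (reconstructed-of-kinds a↦k b↦l)

          w-sym : ∀ a b → w a b ≈ w b a
          w-sym a b = ≈.trans (w≈reconstructed a b)
            (≈.trans (reconstructed-sym a b) (≈.sym (w≈reconstructed b a)))

          -- Condition (b) speaks of pairwise distinct vertices. If a or b is o itself, the two
          -- sides consist of the same three summands.
          cyclic-at-o : ∀ {a b} → a ≢ b → Inner a → Inner b →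
            ((Y (a ∷ o ∷ []) + Y (b ∷ a ∷ [])) + Y (o ∷ b ∷ [])) ≈
            ((Y (o ∷ a ∷ []) + Y (a ∷ b ∷ [])) + Y (b ∷ o ∷ []))
          cyclic-at-o {a} {b} a≢b a-inner b-inner with a ≟ o | b ≟ o
          ... | yes refl | _        = ≈.trans (≈.assoc _ _ _)
            (≈.trans (≈.∙-cong ≈.refl (≈.comm _ _)) (≈.sym (≈.assoc _ _ _)))
          ... | no _     | yes refl = ≈.∙-cong (≈.comm _ _) ≈.refl
          ... | no a≢o   | no b≢o   =
            cyclic o b a (b≢o ∘ sym) (a≢b ∘ sym) (a≢o ∘ sym) (o-inner a-inner) b-inner a-inner

          open Graph w w-sym W W-[-] W-∷ i j

          ≈-pathSum : ∀ {is} → Propositional.Unique is → All Inner is → Y is ≈ W (i ∷ (is ∷ʳ j))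
          ≈-pathSum = interpolation⇒≈-pathSum Y
            (≈.sym (≈.trans (W-edge i j) (w-of-kinds kind-start kind-end)))
            (λ {a} a-inner → ≈.sym (≈.trans (pathSum-single a) (≈.trans
              (≈.∙-cong (w-of-kinds kind-start (kind-inner a-inner))
                        (w-of-kinds (kind-inner a-inner) kind-end))
              (startWeight+endWeight a))))
            (λ {a} {b} a≢b a-inner b-inner → ≈.sym (≈.trans (pathSum-pair a b) (≈.trans
              (≈.∙-cong (w-of-kinds kind-start (kind-inner a-inner))
                (≈.∙-cong (w-of-kinds (kind-inner a-inner) (kind-inner b-inner))
                          (w-of-kinds (kind-inner b-inner) kind-end)))
              (cyclic⇒pair a b (cyclic-at-o a≢b a-inner b-inner)))))
            interpolated

-- Permutations of lists from bijections of their indices.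

map-lookup-allFin : ∀ {A : Set} (xs : List A) → map (lookup xs) (allFin (length xs)) ≡ xs
map-lookup-allFin xs = trans (List.map-tabulate id (lookup xs)) (List.tabulate-lookup xs)

lookup-map : ∀ {A B : Set} (f : A → B) (xs : List A) k →
  lookup (map f xs) (cast (sym (List.length-map f xs)) k) ≡ f (lookup xs k)
lookup-map f (x ∷ xs) zero    = refl
lookup-map f (x ∷ xs) (suc k) = lookup-map f xs k

module _ (S : Setoid 0ℓ 0ℓ) where
  open Setoid S using (Carrier) renaming (_≈_ to _∼_; reflexive to ∼-reflexive)
  open Setoid↭ S using () renaming (_↭_ to _⇌_; ↭-trans to ⇌-trans)
  open Setoid↭ₚ S using (≋⇒↭)

  -- Up to `_∼_`, xs lists the entries of ys at the images under π. These images are duplicate-free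
  -- and exhaust the indices, so they are a permutation of `allFin`.
  bijection⇒↭ : (xs ys : List Carrier) (π : Fin (length xs) ↔ Fin (length ys)) →
    (∀ k → lookup xs k ∼ lookup ys (Inverse.to π k)) → xs ⇌ ys
  bijection⇒↭ xs ys π xs∼ys = ⇌-trans
    (≋⇒↭ (subst (λ zs → Pointwise _∼_ zs (map (lookup ys) (map to (allFin _))))
      (map-lookup-allFin xs)
      (subst (Pointwise _∼_ (map (lookup xs) (allFin _))) (List.map-∘ (allFin _))
        (Pointwise.map⁺ _ _ (Pointwise.refl (λ {k} → xs∼ys k))))))
    (subst (map (lookup ys) (map to (allFin _)) ⇌_) (map-lookup-allFin ys)
      (Setoid↭ₚ.map⁺ (setoid _) S (∼-reflexive ∘ cong (lookup ys)) (Propositional.↭⇒↭ₛ images↭allFin)))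
    where
    open Inverse π
    images↭allFin : map to (allFin _) Propositional.↭ allFin _
    images↭allFin = ∼bag⇒↭ (unique∧set⇒bag
      (Unique.map⁺ (Injection.injective (↔⇒↣ π)) (Unique.allFin⁺ _)) (Unique.allFin⁺ _)
      (λ {k} → mk⇔ (λ _ → ∈.∈-allFin k)
        λ _ → subst (_∈ map to (allFin _)) (strictlyInverseˡ k) (∈.∈-map⁺ to (∈.∈-allFin (from k)))))

-- The enumeration of simple paths.

unique⇒length≤ : ∀ {n} {xs : List (Fin n)} → Unique xs → length xs ℕ.≤ n
unique⇒length≤ xs! = Fin.injective⇒≤ (lookup-injective xs!)

∈-sequences : ∀ {n} (is : List (Fin n)) → is ∈ sequences n (length is)
∈-sequences []       = here refl
∈-sequences (i ∷ is) = ∈.∈-cartesianProductWith⁺ _∷_ (∈.∈-allFin i) (∈-sequences is)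

sequences-length : ∀ {n} r {is : List (Fin n)} → is ∈ sequences n r → length is ≡ r
sequences-length zero    (here refl) = refl
sequences-length (suc r) is∈
  with _ , _ , _ , js∈ , refl ← ∈.∈-cartesianProductWith⁻ _∷_ (allFin _) (sequences _ r) is∈ =
  cong suc (sequences-length r js∈)

sequences-unique : ∀ n r → Propositional.Unique (sequences n r)
sequences-unique n zero    = [] ∷ []
sequences-unique n (suc r) =
  Unique.cartesianProductWith⁺ _∷_ List.∷-injective (Unique.allFin⁺ n) (sequences-unique n r)

module _ {n : ℕ} {i j : Fin n} where

  -- Sequences of one length are listed without repetition, and lists for different lengths are
  -- disjoint.
  interiors-unique : Propositional.Unique (interiors i j)
  interiors-unique = Unique.filter⁺ (λ is → unique? (i ∷ is ∷ʳ j)) (Unique.concat⁺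
    (All.map⁺ (All.tabulate λ {r} _ → sequences-unique n r))
    (AllPairs.map⁺ (AllPairs.map disjoint (Unique.upTo⁺ n))))
    where
    disjoint : ∀ {r s} → r ≢ s → Disjoint (sequences n r) (sequences n s)
    disjoint {r} {s} r≢s (∈r , ∈s) =
      r≢s (trans (sym (sequences-length r ∈r)) (sequences-length s ∈s))

  -- The stored proof is irrelevant; decidability of uniqueness gives back a usable one.
  interior-simple : (p : SimplePath i j) → Unique (i ∷ interior p ∷ʳ j)
  interior-simple (mkPath is simple) = recompute (unique? (i ∷ is ∷ʳ j)) simple

  interior∈interiors : (p : SimplePath i j) → interior p ∈ interiors i j
  interior∈interiors p = ∈.∈-filter⁺ (λ is → unique? (i ∷ is ∷ʳ j))
    (∈.∈-concatMap⁺ (sequences n) (Any.map (λ { refl → ∈-sequences is }) (∈.∈-upTo⁺ |is|<n)))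
    (interior-simple p)
    where
    is = interior p
    |is|<n : length is ℕ.< n
    -- Counting i together with the interior already yields the strict bound that `upTo n` requires.
    |is|<n = ℕ.≤-trans (ℕ.s≤s (List.length-++-≤ˡ is))
      (unique⇒length≤ (interior-simple p))

  interior-injective : {p q : SimplePath i j} → interior p ≡ interior q → p ≡ q
  interior-injective refl = refl

  -- A path corresponds to the position of its interior. One round trip rests on the absence of
  -- repetitions in `interiors`, the other on the irrelevance of the simplicity proof.
  simplePath↔index : SimplePath i j ↔ Fin (length (interiors i j))
  simplePath↔index = mk↔ₛ′
    (λ p → Any.index (interior∈interiors p))
    (λ k → mkPath (lookup (interiors i j) k) (simple k))
    (λ k → lookup-injective interiors-unique (sym (Any.lookup-index (interior∈interiors _))))
    (λ p → interior-injective (sym (Any.lookup-index (interior∈interiors p))))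
    where
    simple : ∀ k → Unique (i ∷ lookup (interiors i j) k ∷ʳ j)
    simple k = proj₂ (∈.∈-filter⁻ (λ is → unique? (i ∷ is ∷ʳ j))
      {xs = concatMap (sequences n) (upTo n)} (∈.∈-lookup k))

  module _ {B : Set} (f : List (Fin n) → B) where

    simplePath↔mapIndex : SimplePath i j ↔ Fin (length (map f (interiors i j)))
    simplePath↔mapIndex =
      ↔-trans simplePath↔index (Fin.cast-id (sym (List.length-map f (interiors i j))))

    lookup-mapIndex : ∀ p →
      lookup (map f (interiors i j)) (Inverse.to simplePath↔mapIndex p) ≡ f (interior p)
    lookup-mapIndex p = trans (lookup-map f (interiors i j) _)
      (cong f (sym (Any.lookup-index (interior∈interiors p))))

-- Arithmetic of Cauchy reals up to `_≈_`.

open +-*-Solver using (solve; con; _:+_; _:-_; _:*_; :-_; _:=_)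

module ℝ-setoid = Setoid ℝ-setoid

≈-by-difference : ∀ x y a b → a ≈ b →
  (∀ n → seq x n ℚ.- seq y n ≡ seq a n ℚ.- seq b n) → x ≈ y
≈-by-difference x y a b a≈b eq ε 0<ε with N , a≈b< ← a≈b ε 0<ε =
  N , λ n N≤n → subst (λ p → ∣ p ∣ ℚ.< ε) (sym (eq n)) (a≈b< n N≤n)

pointwise⇒≈ : ∀ x y → (∀ n → seq x n ≡ seq y n) → x ≈ y
pointwise⇒≈ x y eq = ≈-by-difference x y 0ℝ 0ℝ (≈-refl {0ℝ}) λ n →
  trans (cong (ℚ._- seq y n) (eq n)) (ℚ.+-inverseʳ (seq y n))

+-cong : ∀ {x x′ y y′} → x ≈ x′ → y ≈ y′ → x + y ≈ x′ + y′
+-cong {x} {x′} {y} {y′} x≈x′ y≈y′ ε 0<ε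
  with M , x< ← x≈x′ (½ ℚ.* ε) (0<½*ε 0<ε)
     | N , y< ← y≈y′ (½ ℚ.* ε) (0<½*ε 0<ε) =
  M ⊔ N , λ n M⊔N≤n → subst (λ p → ∣ p ∣ ℚ.< ε)
    (solve 4 (λ p q r s → (p :- q) :+ (r :- s) := (p :+ r) :- (q :+ s)) refl
      (seq x n) (seq x′ n) (seq y n) (seq y′ n))
    (∣p+q∣<ε (seq x n ℚ.- seq x′ n) (seq y n ℚ.- seq y′ n)
      (x< n (ℕ.m⊔n≤o⇒m≤o M N M⊔N≤n))
      (y< n (ℕ.m⊔n≤o⇒n≤o M N M⊔N≤n)))

minus-cong : ∀ {x x′ y y′} → x ≈ x′ → y ≈ y′ → x - y ≈ x′ - y′
minus-cong {x} {x′} {y} {y′} x≈x′ y≈y′ = +-cong {x} {x′} {(- y)} {(- y′)} x≈x′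
  (≈-by-difference (- y) (- y′) y′ y (≈-sym {y} {y′} y≈y′) λ n →
    solve 2 (λ p q → :- p :- :- q := q :- p) refl (seq y n) (seq y′ n))

½*-cong : ∀ {x y} → x ≈ y → ½* x ≈ ½* y
½*-cong {x} {y} x≈y ε 0<ε
  -- Halving also halves the distance, so a tolerance of 2ε suffices.
  with N , x< ← x≈y (ε ℚ.+ ε) (subst (ℚ._< ε ℚ.+ ε) (ℚ.+-identityˡ 0ℚ) (ℚ.+-mono-< 0<ε 0<ε)) =
  N , λ n N≤n → subst (∣ ½ ℚ.* seq x n ℚ.- ½ ℚ.* seq y n ∣ ℚ.<_)
    (solve 1 (λ e → con ½ :* (e :+ e) := e) refl ε)
    (subst (ℚ._< ½ ℚ.* (ε ℚ.+ ε))
      (trans (sym (ℚ.∣p*q∣≡∣p∣*∣q∣ ½ (seq x n ℚ.- seq y n)))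
        (cong ∣_∣ (solve 3 (λ h p q → h :* (p :- q) := h :* p :- h :* q) refl
          ½ (seq x n) (seq y n))))
      (ℚ.*-monoʳ-<-pos ½ (x< n N≤n)))

+-isCommutativeMonoid : IsCommutativeMonoid _≈_ _+_ 0ℝ
+-isCommutativeMonoid = record
  { isMonoid = record
    { isSemigroup = record
      { isMagma = record
        { isEquivalence = ℝ-setoid.isEquivalence
        ; ∙-cong = λ {x} {x′} {y} {y′} → +-cong {x} {x′} {y} {y′}
        }
      ; assoc = λ x y z → pointwise⇒≈ ((x + y) + z) (x + (y + z)) λ n →
          ℚ.+-assoc (seq x n) (seq y n) (seq z n)
      }
    ; identity = (λ x → pointwise⇒≈ (0ℝ + x) x λ n → ℚ.+-identityˡ (seq x n))
               , (λ x → pointwise⇒≈ (x + 0ℝ) x λ n → ℚ.+-identityʳ (seq x n))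
    }
  ; comm = λ x y → pointwise⇒≈ (x + y) (y + x) λ n → ℚ.+-comm (seq x n) (seq y n)
  }

module ℝ-PathSums = PathSums {ℝ} {_≈_} {_+_} {_-_} {0ℝ} {½*_} {∑}
  +-isCommutativeMonoid
  (λ {x} {x′} {y} {y′} → minus-cong {x} {x′} {y} {y′})
  (λ x y → pointwise⇒≈ ((x - y) + y) x λ n →
    solve 2 (λ p q → (p :- q) :+ q := p) refl (seq x n) (seq y n))
  (λ x y → pointwise⇒≈ ((x + y) - y) x λ n →
    solve 2 (λ p q → (p :+ q) :- q := p) refl (seq x n) (seq y n))
  (λ {x} {y} → ½*-cong {x} {y})
  (λ x → pointwise⇒≈ (½* (x + x)) x λ n →
    solve 1 (λ p → con ½ :* (p :+ p) := p) refl (seq x n))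
  (λ x → pointwise⇒≈ ((½* x) + (½* x)) x λ n → ½*ε+½*ε≡ε (seq x n))
  (λ f → pointwise⇒≈ (∑ f) 0ℝ λ n → refl)
  (λ f → pointwise⇒≈ (∑ f) (f zero + ∑ (f ∘ suc)) λ n → refl)

-- Path weights of real weighted graphs satisfy both conditions.

module _ {n : ℕ} (G : WeightedCompleteGraph n) where

  pathWeight-[-] : ∀ a → pathWeight G (a ∷ []) ≈ 0ℝ
  pathWeight-[-] a = pointwise⇒≈ (pathWeight G (a ∷ [])) 0ℝ λ n → refl

  pathWeight-∷ : ∀ a b is →
    pathWeight G (a ∷ b ∷ is) ≈ weight G a b + pathWeight G (b ∷ is)
  pathWeight-∷ a b is =
    pointwise⇒≈ (pathWeight G (a ∷ b ∷ is)) (weight G a b + pathWeight G (b ∷ is)) λ n → refl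

module _ {Y : List ℝ} {n : ℕ} {i j : Fin n} (I : Indexing Y i j) where
  open Indexing I

  module _ (G : WeightedCompleteGraph n)
    (y≈pathWeight : ∀ is → y is ≈ pathWeight G (i ∷ is ∷ʳ j)) where
    open ℝ-PathSums.Graph (weight G) (weight-sym G) (pathWeight G)
      (pathWeight-[-] G) (pathWeight-∷ G) i j
      using (interpolation-≈-pathSum; cyclic-≈-pathSum)

    pathWeight⇒ConditionA : ConditionA I
    pathWeight⇒ConditionA k v _ _ = interpolation-≈-pathSum y y≈pathWeight k v

    pathWeight⇒ConditionB : ConditionB I
    pathWeight⇒ConditionB l o m _ _ _ _ _ _ = cyclic-≈-pathSum y y≈pathWeight l o m

-- Equality of multisets versus indexings by simple paths.

module _ {n : ℕ} {i j : Fin n} where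

  -- The permutation supplies only the positions. The family y is the path weight on all lists, so
  -- the second component holds beyond simple paths as well.
  ↭⇒Indexing : (G : WeightedCompleteGraph n) (Y : List ℝ) → Y ↭ 𝒟 i j G →
    Σ[ I ∈ Indexing Y i j ] (∀ is → Indexing.y I is ≈ pathWeight G (i ∷ is ∷ʳ j))
  ↭⇒Indexing G Y Y↭𝒟 = record
    { position = position
    ; y        = y
    ; y-lookup = y-lookup
    } , λ is → ≈-refl {y is}
    where
    y : List (Fin n) → ℝ
    y is = pathWeight G (i ∷ is ∷ʳ j)

    index : Fin (length Y) ↔ Fin (length (𝒟 i j G))
    index = Homogeneous.onIndices Y↭𝒟

    position : SimplePath i j ↔ Fin (length Y)
    position = ↔-trans (simplePath↔mapIndex y) (↔-sym index)

    y-lookup : ∀ p → y (interior p) ≈ lookup Y (Inverse.to position p)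
    y-lookup p = subst (_≈ lookup Y (Inverse.to position p))
      (trans
        (cong (lookup (𝒟 i j G))
          (Inverse.strictlyInverseˡ index (Inverse.to (simplePath↔mapIndex y) p)))
        (lookup-mapIndex y p))
      (≈-sym {lookup Y (Inverse.to position p)}
        {lookup (𝒟 i j G) (Inverse.to index (Inverse.to position p))}
        (Setoid↭ₚ.onIndices-lookup ℝ-setoid Y↭𝒟 (Inverse.to position p)))

  -- An index of Y goes to the simple path placed there and on to the position of that path in
  -- `𝒟 i j G`; the values at both ends agree.
  Indexing⇒↭ : (G : WeightedCompleteGraph n) (Y : List ℝ) (I : Indexing Y i j) →
    (∀ p → Indexing.y I (interior p) ≈ pathWeight G (i ∷ interior p ∷ʳ j)) → Y ↭ 𝒟 i j G
  Indexing⇒↭ G Y I y≈weight = bijection⇒↭ ℝ-setoid Y (𝒟 i j G) index index-lookup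
    where
    open Indexing I
    w : List (Fin n) → ℝ
    w is = pathWeight G (i ∷ is ∷ʳ j)

    index : Fin (length Y) ↔ Fin (length (𝒟 i j G))
    index = ↔-trans (↔-sym position) (simplePath↔mapIndex w)

    index-lookup : ∀ k → lookup Y k ≈ lookup (𝒟 i j G) (Inverse.to index k)
    index-lookup k = subst₂ _≈_
      (cong (lookup Y) (Inverse.strictlyInverseˡ position k))
      (sym (lookup-mapIndex w p))
      (≈-trans {lookup Y (Inverse.to position p)} {y (interior p)} {w (interior p)}
        (≈-sym {y (interior p)} {lookup Y (Inverse.to position p)} (y-lookup p)) (y≈weight p))
      where p = Inverse.from position k

-- From the two conditions to a weighted graph.

unique-∷ʳ⁻ : ∀ {n} {j : Fin n} is → Unique (is ∷ʳ j) → Unique is × All (_≢ j) is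
unique-∷ʳ⁻ []       _ = [] , []
unique-∷ʳ⁻ (a ∷ is) (a∉ ∷ is!) =
  let is! , is≢j = unique-∷ʳ⁻ is is! in
  All.++⁻ˡ is a∉ ∷ is! , All.head (All.++⁻ʳ is a∉) ∷ is≢j

simple⇒inner : ∀ {n} {i j : Fin n} {is} → Unique (i ∷ is ∷ʳ j) →
  Unique is × All (λ a → a ≢ i × a ≢ j) is
simple⇒inner {is = is} (i∉ ∷ is!) =
  let is! , is≢j = unique-∷ʳ⁻ is is! in
  is! , All.zip (All.map (_∘ sym) (All.++⁻ˡ is i∉) , is≢j)

inner-vertex : ∀ {n} (i j : Fin n) →
  Σ[ o ∈ Fin n ] (∀ {a} → a ≢ i × a ≢ j → o ≢ i × o ≢ j)
inner-vertex i j with Fin.any? (λ a → ¬? (a Fin.≟ i) ×-dec ¬? (a Fin.≟ j))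
... | yes (o , o-inner) = o , λ _ → o-inner
-- Without inner vertices any base vertex will do: the implication is vacuous.
... | no ∄inner         = i , λ a-inner → contradiction (_ , a-inner) ∄inner

conditions⇒≈-pathWeight : ∀ {Y : List ℝ} {n} {i j : Fin n} → i ≢ j → (I : Indexing Y i j) →
  ConditionA I → ConditionB I →
  Σ[ G ∈ WeightedCompleteGraph n ]
    (∀ (p : SimplePath i j) → Indexing.y I (interior p) ≈ pathWeight G (i ∷ interior p ∷ʳ j))
conditions⇒≈-pathWeight {Y} {n} {i} {j} i≢j I conditionA conditionB = graph , λ p →
  let is! , inner = simple⇒inner {i = i} {j} (interior-simple p) in
  approximates graph (λ a b → ≈-refl {weight graph a b}) is! inner
  where
  open Indexing I
  o = proj₁ (inner-vertex i j)
  module Rec = ℝ-PathSums.Reconstruction y o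
  w = Rec.reconstructed Fin._≟_ i j i≢j

  graph : WeightedCompleteGraph n
  graph = record { weight = w ; weight-sym = Rec.reconstructed-sym Fin._≟_ i j i≢j }

  -- `G` is a variable whose weights are known only up to `_≈_`, so the reconstructed weights stay
  -- opaque.
  approximates : (G : WeightedCompleteGraph n) →
    (∀ a b → weight G a b ≈ w a b) →
    ∀ {is} → Unique is → All (λ a → a ≢ i × a ≢ j) is →
    y is ≈ pathWeight G (i ∷ is ∷ʳ j)
  approximates G w≈ = Rec.≈-pathSum Fin._≟_ i j i≢j (weight G) w≈
    (pathWeight G) (pathWeight-[-] G) (pathWeight-∷ G)
    (proj₂ (inner-vertex i j)) conditionA conditionB

theorem8 : (n : ℕ) → 2 ≤ n → (Y : List ℝ) → length Y ≡ N n →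
    (Σ[ G ∈ WeightedCompleteGraph n ] Σ[ i ∈ Fin n ] Σ[ j ∈ Fin n ] (i ≢ j × Y ↭ 𝒟 i j G))
    ⇔
    (Σ[ i ∈ Fin n ] Σ[ j ∈ Fin n ] (i ≢ j × (Σ[ I ∈ Indexing Y i j ] (ConditionA I × ConditionB I))))
theorem8 n _ Y _ = mk⇔
  (λ { (G , i , j , i≢j , Y↭𝒟) →
    let I , y≈ = ↭⇒Indexing {i = i} {j} G Y Y↭𝒟 in
    i , j , i≢j , I ,
    pathWeight⇒ConditionA {i = i} {j} I G y≈ , pathWeight⇒ConditionB {i = i} {j} I G y≈ })
  (λ { (i , j , i≢j , I , a , b) →
    let G , y≈ = conditions⇒≈-pathWeight i≢j I a b in
    G , i , j , i≢j , Indexing⇒↭ {i = i} {j} G Y I y≈ })
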